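{- For every integer $k\ge 1$ the sequence $S^{(1)}_k=\bigl(S^{(1)}(n+k-1,k)\bigr)_{n\ge1}$ of (signless) Stirling numbers of the first kind is not almost realizable.
   Context: For $n\ge 1$ and $0\le k\le n$, $S^{(1)}(n,k)$ denotes the (signless) Stirling number of the first kind: the number of permutations of $\{1,\dots,n\}$ with exactly $k$ cycles (fixed points count as cycles). For $k\ge1$, $S^{(1)}_k$ is the sequence whose $n$-th term ($n\ge1$) is $S^{(1)}(n+k-1,k)$; for example $S^{(1)}_3=(1,6,35,225,\dots)$. For an integer sequence $A=(A_n)_{n\ge1}$ write $(\mu*A)(n)=\sum_{d\mid n}\mu(n/d)A_d$, where $\mu$ is the classical Möbius function. For a rational number $x$, $\mathrm{Denom}(x)$ denotes the (positive) denominator of $x$ written in lowest terms. For a sequence $A$ of non-negative integers define $$\mathrm{Fail}(A)=\mathrm{lcm}\bigl(\{\mathrm{Denom}\bigl(\tfrac1n(\mu*A)(n)\bigr)\mid n\ge1\}\bigr)$$ if this is finite, and $\mathrm{Fail}(A)=\infty$ otherwise. The sequence $A$ is called almost realizable if $\mathrm{Fail}(A)<\infty$ and $A$ satisfies the sign condition $(\mu*A)(n)\ge0$ for all $n\ge1$. -}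

module Defs where

open import Data.Bool.Base using (if_then_else_)
import Data.Bool.Properties as Bool
open import Data.Fin.Base using (Fin)
import Data.Fin.Properties as Fin
open import Data.Fin.Subset using (Subset)
open import Data.Integer.Base as ℤ using (ℤ; +_; -1ℤ; 0ℤ)
open import Data.List.Base as List using (List; []; _∷_)
import Data.List.Membership.DecPropositional as DecMembership
open import Data.List.Relation.Unary.Unique.DecPropositional using (unique?)
open import Data.Nat.Base using (ℕ; zero; suc; _+_; _∸_; _/_; NonZero)
open import Data.Nat.Divisibility using (_∣_; _∣?_)
open import Data.Nat.Primality.Factorisation using (factors; factorise)
import Data.Nat.Properties as ℕ
open import Data.Product.Base using (_×_; ∃-syntax)
import Data.Rational.Base as ℚ
open import Data.Vec.Base as Vec using (Vec; []; _∷_)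
import Data.Vec.Properties as Vec
open import Relation.Nullary.Decidable.Core using (does)

------------------------------------------------------------------------
-- Permutations and Stirling numbers of the first kind

words : ∀ n m → List (Vec (Fin n) m)
words n zero    = [] ∷ []
words n (suc m) = List.cartesianProductWith _∷_ (List.allFin n) (words n m)

-- One-line notation: σ maps i to lookup σ i, and a self-map of Fin n is a
-- permutation iff its values are pairwise distinct.
permutations : ∀ n → List (Vec (Fin n) n)
permutations n =
  List.filter (λ σ → unique? Fin._≟_ (Vec.toList σ)) (words n n)

-- The set { i , σ i , σ² i , … }; the first n iterates exhaust it.
cycleOf : ∀ {n} → Vec (Fin n) n → Fin n → Subset n
cycleOf {n} σ i =
  Vec.tabulate (λ j → does (j ∈? List.iterate (Vec.lookup σ) i n))
  where open DecMembership Fin._≟_ using (_∈?_)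

cycles : ∀ {n} → Vec (Fin n) n → List (Subset n)
cycles {n} σ =
  List.deduplicate (Vec.≡-dec Bool._≟_) (List.map (cycleOf σ) (List.allFin n))

stirling₁ : ℕ → ℕ → ℕ
stirling₁ n k =
  List.length
    (List.filter (λ σ → List.length (cycles σ) ℕ.≟ k) (permutations n))

-- Sequences (Aₙ)ₙ≥₁ are functions on ℕ; the value at 0 is never used.
S⁽¹⁾ : ℕ → ℕ → ℕ
S⁽¹⁾ k n = stirling₁ (n + k ∸ 1) k

------------------------------------------------------------------------
-- Dirichlet convolution with the Möbius function

μ : ℕ → ℤ
μ zero      = 0ℤ
μ n@(suc _) =
  if does (unique? ℕ._≟_ ps) then -1ℤ ℤ.^ List.length ps else 0ℤ
  where
  -- prime factors listed with multiplicity, so distinct iff n is squarefree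
  ps : List ℕ
  ps = factors (factorise n)

infixl 7 _⋆_

-- (f ⋆ g) n = ∑_{d ∣ n} f (n / d) g d, with d = suc i ranging over 1, …, n.
_⋆_ : (ℕ → ℤ) → (ℕ → ℤ) → ℕ → ℤ
(f ⋆ g) n = List.foldr ℤ._+_ 0ℤ (List.map term (List.upTo n))
  where
  term : ℕ → ℤ
  term i = if does (suc i ∣? n) then f (n / suc i) ℤ.* g (suc i) else 0ℤ

------------------------------------------------------------------------
-- Almost realizable sequences

μ⋆ : (ℕ → ℕ) → ℕ → ℤ
μ⋆ A = μ ⋆ (λ n → + A n)

denom : (ℕ → ℕ) → (n : ℕ) .{{_ : NonZero n}} → ℕ
denom A n = ℚ.↧ₙ (μ⋆ A n ℚ./ n)

-- Fail(A) = m for a finite m.  The lcm must be positive: 0 is a common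
-- multiple of every set, and is the least one (for divisibility) exactly
-- when Fail(A) = ∞.
record IsFail (A : ℕ → ℕ) (m : ℕ) : Set where
  field
    positive : NonZero m
    multiple : ∀ n .{{_ : NonZero n}} → denom A n ∣ m
    least    : ∀ l → (∀ n .{{_ : NonZero n}} → denom A n ∣ l) → m ∣ l

FailFinite : (ℕ → ℕ) → Set
FailFinite A = ∃[ m ] IsFail A m

SignCondition : (ℕ → ℕ) → Set
SignCondition A = ∀ n .{{_ : NonZero n}} → 0ℤ ℤ.≤ μ⋆ A n

AlmostRealizable : (ℕ → ℕ) → Set
AlmostRealizable A = FailFinite A × SignCondition A

{-# OPTIONS --safe #-}
-- For a prime p > k let n = p + k - 1 and let c ∈ Sₙ be a p-cycle fixing the other k - 1 points.
-- Conjugation by c acts on the permutations of n points with k cycles, with orbits of size 1 or p.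
-- A fixed point σ commutes with c, so it acts on the p-cycle as a power of c and permutes the other
-- points; having exactly k < p cycles forces that power to be nontrivial and σ to fix the other
-- points.  So the fixed points are c, c², …, cᵖ⁻¹, and S(p+k-1, k) ≡ -1 (mod p).  Since
-- (μ * A)(p) = A(p) - A(1), every prime p > max(k, A(1) + 1) divides the p-th denominator, and
-- Fail(A) is infinite.
module Submission where

open import Data.Bool.Base using (if_then_else_)
import Data.Bool.Properties as Bool
open import Data.Fin.Base using (Fin; toℕ; _↑ˡ_; _↑ʳ_; splitAt; join)
import Data.Fin.Properties as Fin
open import Data.Fin.Subset using (Subset) renaming (_∈_ to _∈ˢ_)
import Data.Fin.Subset.Properties as Subset
open import Data.Integer.Base as ℤ using (ℤ; +_; -1ℤ; 0ℤ; 1ℤ)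
import Data.Integer.Divisibility.Signed as ℤ
import Data.Integer.GCD as ℤ
import Data.Integer.Properties as ℤ
open import Data.Integer.Solver using () renaming (module +-*-Solver to ℤ-Solver)
open import Data.List.Base as List
  using (List; []; _∷_; length; filter; applyUpTo; deduplicate; map; foldr; allFin)
import Data.List.Membership.DecPropositional as DecMembership
open import Data.List.Membership.Propositional using (_∈_; _∉_)
open import Data.List.Membership.Propositional.Properties
import Data.List.Properties as List
open import Data.List.Relation.Binary.Permutation.Propositional.Properties using (↭-singleton-inv)
open import Data.List.Relation.Binary.Subset.Propositional using (_⊆_)
open import Data.List.Relation.Unary.All as All using ([]; _∷_)
import Data.List.Relation.Unary.All.Properties as All
open import Data.List.Relation.Unary.AllPairs using ([]; _∷_)
open import Data.List.Relation.Unary.Any as Any using (here; there)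
import Data.List.Relation.Unary.Any.Properties as Any
open import Data.List.Relation.Unary.Unique.DecPropositional using (unique?)
import Data.List.Relation.Unary.Unique.DecPropositional.Properties as DecUnique
open import Data.List.Relation.Unary.Unique.Propositional using (Unique)
import Data.List.Relation.Unary.Unique.Propositional.Properties as Unique
open import Data.Nat.Base
open import Data.Nat.Coprimality using (Coprime; coprime-Bézout; prime⇒coprime)
open import Data.Nat.Divisibility
open import Data.Nat.DivMod
  using (_mod_; m≡m%n+[m/n]*n; m%n<n; m<n⇒m%n≡m; n%n≡0; %-distribˡ-+; n/1≡n; n/n≡1)
open import Data.Nat.GCD using (module Bézout)
open import Data.Nat.GeneralisedArithmetic using (iterate)
open import Data.Nat.Induction using (<-wellFounded; Acc; acc)
open import Data.Nat.ListAction using (product)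
open import Data.Nat.Primality
  using (Prime; prime⇒nonZero; prime⇒nonTrivial; prime⇒irreducible; euclidsLemma; ¬prime[1])
open import Data.Nat.Primality.Factorisation
  using (factorise; factorisationUnique; primeFactorisation[p])
import Data.Nat.Properties as ℕ
open import Data.Nat.Solver using (module +-*-Solver)
open import Data.Product.Base using (∃-syntax; _×_; _,_; proj₁; proj₂)
import Data.Rational.Base as ℚ
import Data.Rational.Properties as ℚ
open import Data.Sum.Base using (_⊎_; inj₁; inj₂; [_,_]′)
open import Data.Vec.Base as Vec using (Vec; []; _∷_; lookup; tabulate)
import Data.Vec.Properties as Vec
open import Function.Base using (_∘_; case_of_)
open import Function.Bundles using (mk⇔)
open import Function.Definitions using (Injective)
open import Relation.Binary.Definitions using (DecidableEquality)
open import Relation.Binary.PropositionalEquality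
open import Relation.Nullary using (¬_; Dec; yes; no; contradiction; ¬?; does)
open import Relation.Nullary.Decidable using (does-⇔; dec-true)
open import Relation.Unary using (Decidable)
open import Defs

-- Iterated functions

module _ {A : Set} (f : A → A) where

  iterate-+ : ∀ x m n → iterate f x (m + n) ≡ iterate f (iterate f x m) n
  iterate-+ x zero    n = refl
  iterate-+ x (suc m) n = iterate-+ (f x) m n

  -- The common source of the later exchange rules: `h` may be `f` itself, the conjugating map, a
  -- map commuting with `f`, or the inclusion of `Fin p` into `Fin (p + d)`.
  iterate-semiconj : ∀ {B : Set} (g : B → B) (h : B → A) →
                     (∀ y → f (h y) ≡ h (g y)) →
                     ∀ y m → iterate f (h y) m ≡ h (iterate g y m)
  iterate-semiconj g h eq y zero    = refl
  iterate-semiconj g h eq y (suc m) =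
    trans (cong (λ x → iterate f x m) (eq y)) (iterate-semiconj g h eq (g y) m)

  iterate-shift : ∀ x m → iterate f (f x) m ≡ f (iterate f x m)
  iterate-shift = iterate-semiconj f f (λ _ → refl)

  iterate-injective : Injective _≡_ _≡_ f →
                      ∀ m → Injective _≡_ _≡_ (λ x → iterate f x m)
  iterate-injective inj zero    eq = eq
  iterate-injective inj (suc m) eq = inj (iterate-injective inj m eq)

  module _ {x : A} {r : ℕ} (period : iterate f x r ≡ x) where

    iterate-* : ∀ t → iterate f x (t * r) ≡ x
    iterate-* zero    = refl
    iterate-* (suc t) = begin
      iterate f x (r + t * r)              ≡⟨ iterate-+ x r (t * r) ⟩
      iterate f (iterate f x r) (t * r)    ≡⟨ cong (λ y → iterate f y (t * r)) period ⟩
      iterate f x (t * r)                  ≡⟨ iterate-* t ⟩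
      x                                    ∎
      where open ≡-Reasoning

    iterate-*-+ : ∀ t m → iterate f x (t * r + m) ≡ iterate f x m
    iterate-*-+ t m =
      trans (iterate-+ x (t * r) m) (cong (λ y → iterate f y m) (iterate-* t))

    iterate-% : ∀ m .{{_ : NonZero r}} → iterate f x (m % r) ≡ iterate f x m
    iterate-% m = begin
      iterate f x (m % r)                  ≡⟨ iterate-*-+ (m / r) (m % r) ⟨
      iterate f x (m / r * r + m % r)      ≡⟨ cong (iterate f x) (ℕ.+-comm (m / r * r) _) ⟩
      iterate f x (m % r + m / r * r)      ≡⟨ cong (iterate f x) (m≡m%n+[m/n]*n m r) ⟨
      iterate f x m                        ∎
      where open ≡-Reasoning

  iterate≡applyUpTo : ∀ x n → List.iterate f x n ≡ applyUpTo (iterate f x) n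
  iterate≡applyUpTo x zero    = refl
  iterate≡applyUpTo x (suc n) = cong (x ∷_) (iterate≡applyUpTo (f x) n)

-- Iterates with a prime period

inverse-mod : ∀ {p a} → Coprime p a → .{{NonZero p}} →
              ∃[ m ] ∃[ s ] ∃[ t ] s * p + m * a ≡ t * p + 1
inverse-mod {suc q} {a} coprime with coprime-Bézout coprime
... | Bézout.-+ x y eq = y , 0 , x , trans (sym eq) (ℕ.+-comm 1 _)
-- Here y * a ≡ -1 modulo p = q + 1, so y is multiplied by q ≡ -1. The summand 1 * p on the left
-- avoids subtraction.
... | Bézout.+- x y eq = q * y , 1 , q * x , (begin
  1 * suc q + q * y * a        ≡⟨ solve 3 (λ q y a → con 1 :* (con 1 :+ q) :+ q :* y :* a
                                     := q :* (con 1 :+ y :* a) :+ con 1) refl q y a ⟩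
  q * (1 + y * a) + 1          ≡⟨ cong (λ z → q * z + 1) eq ⟩
  q * (x * suc q) + 1          ≡⟨ cong (_+ 1) (ℕ.*-assoc q x (suc q)) ⟨
  q * x * suc q + 1            ∎)
  where open ≡-Reasoning
        open +-*-Solver

-- An exponent a prime to p is invertible modulo p, so `f` is recovered as a power of its a-th
-- iterate. The exponent m depends only on p and a, not on `f` or the point.
generator : ∀ {p a} → Prime p → 0 < a → a < p →
            ∃[ m ] (∀ {A : Set} (f : A → A) {x} → iterate f x p ≡ x → iterate f x (m * a) ≡ f x)
generator {p} {a} pp 0<a a<p
  with m , s , t , eq ← inverse-mod (prime⇒coprime pp {{>-nonZero 0<a}} a<p) {{prime⇒nonZero pp}}
  = m , λ f {x} per → begin
    iterate f x (m * a)          ≡⟨ iterate-*-+ f per s (m * a) ⟨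
    iterate f x (s * p + m * a)  ≡⟨ cong (iterate f x) eq ⟩
    iterate f x (t * p + 1)      ≡⟨ iterate-*-+ f per t 1 ⟩
    f x                          ∎
  where open ≡-Reasoning

iterate-prime-fixed : ∀ {A : Set} {f : A → A} {x p a} → Prime p → iterate f x p ≡ x →
                      0 < a → a < p → iterate f x a ≡ x → f x ≡ x
iterate-prime-fixed {f = f} pp per 0<a a<p fix with m , gen ← generator pp 0<a a<p =
  trans (sym (gen f per)) (iterate-* f fix m)

-- If the i-th and j-th iterates agree, then p - j further steps show that x returns after i + (p -
-- j) steps. This number lies strictly between 0 and p, so x would be a fixed point.
iterate-prime-distinct : ∀ {A : Set} {f : A → A} {x p} → Prime p → iterate f x p ≡ x → f x ≢ x →
                         ∀ {i j} → i < j → j < p → iterate f x i ≢ iterate f x j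
iterate-prime-distinct {f = f} {x} {p} pp per f≢ {i} {j} i<j j<p eq =
  f≢ (iterate-prime-fixed pp per
        (ℕ.≤-trans (ℕ.m<n⇒0<n∸m j<p) (ℕ.m≤n+m _ i))
        (ℕ.<-≤-trans (ℕ.+-monoˡ-< (p ∸ j) i<j) (ℕ.≤-reflexive j+))
        (begin
          iterate f x (i + (p ∸ j))              ≡⟨ iterate-+ f x i _ ⟩
          iterate f (iterate f x i) (p ∸ j)      ≡⟨ cong (λ y → iterate f y (p ∸ j)) eq ⟩
          iterate f (iterate f x j) (p ∸ j)      ≡⟨ iterate-+ f x j _ ⟨
          iterate f x (j + (p ∸ j))              ≡⟨ cong (iterate f x) j+ ⟩
          iterate f x p                          ≡⟨ per ⟩
          x                                      ∎))
  where
  open ≡-Reasoning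
  j+ : j + (p ∸ j) ≡ p
  j+ = ℕ.m+[n∸m]≡n (ℕ.<⇒≤ j<p)

-- Counting distinct elements of lists

module _ {A : Set} where

  Unique-tabulate⁻ : ∀ {n} {f : Fin n → A} → Unique (List.tabulate f) →
                     Injective _≡_ _≡_ f
  Unique-tabulate⁻ (x∉ ∷ u) {Fin.zero}  {Fin.zero}  eq = refl
  Unique-tabulate⁻ (x∉ ∷ u) {Fin.zero}  {Fin.suc j} eq =
    contradiction eq (All.tabulate⁻ x∉ j)
  Unique-tabulate⁻ (x∉ ∷ u) {Fin.suc i} {Fin.zero}  eq =
    contradiction (sym eq) (All.tabulate⁻ x∉ i)
  Unique-tabulate⁻ (x∉ ∷ u) {Fin.suc i} {Fin.suc j} eq =
    cong Fin.suc (Unique-tabulate⁻ u eq)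

  lookup-injective : ∀ {xs : List A} → Unique xs → Injective _≡_ _≡_ (List.lookup xs)
  lookup-injective {xs} u = Unique-tabulate⁻ (subst Unique (sym (List.tabulate-lookup xs)) u)

  Unique-⊆⇒length≤ : ∀ {xs ys : List A} → Unique xs → xs ⊆ ys → length xs ≤ length ys
  Unique-⊆⇒length≤ {xs} {ys} u sub = Fin.injective⇒≤ {f = f} f-inj
    where
    f : Fin (length xs) → Fin (length ys)
    f i = Any.index (sub (∈-lookup {xs = xs} i))
    f-inj : Injective _≡_ _≡_ f
    f-inj {i} {j} eq = lookup-injective u (begin
      List.lookup xs i      ≡⟨ Any.lookup-index (sub (∈-lookup {xs = xs} i)) ⟩
      List.lookup ys (f i)  ≡⟨ cong (List.lookup ys) eq ⟩
      List.lookup ys (f j)  ≡⟨ Any.lookup-index (sub (∈-lookup {xs = xs} j)) ⟨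
      List.lookup xs j      ∎)
      where open ≡-Reasoning

  Unique-⊆-antisym : ∀ {xs ys : List A} → Unique xs → Unique ys → xs ⊆ ys → ys ⊆ xs →
                     length xs ≡ length ys
  Unique-⊆-antisym u v s t = ℕ.≤-antisym (Unique-⊆⇒length≤ u s) (Unique-⊆⇒length≤ v t)

  length-filter-¬? : ∀ {P : A → Set} (P? : Decidable P) xs →
                     length xs ≡ length (filter P? xs) + length (filter (¬? ∘ P?) xs)
  length-filter-¬? P? []       = refl
  length-filter-¬? P? (x ∷ xs) with P? x
  ... | yes _ = cong suc (length-filter-¬? P? xs)
  ... | no  _ = trans (cong suc (length-filter-¬? P? xs)) (sym (ℕ.+-suc _ _))

module _ {A : Set} (_≟_ : DecidableEquality A) where

  distinct : List A → ℕ
  distinct xs = length (deduplicate _≟_ xs)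

  distinct-≤ : ∀ xs {ys} → xs ⊆ ys → distinct xs ≤ length ys
  distinct-≤ xs sub =
    Unique-⊆⇒length≤ (DecUnique.deduplicate-! _≟_ xs) (sub ∘ ∈-deduplicate⁻ _≟_ xs)

  distinct-⊆ : ∀ xs {ys} → xs ⊆ ys → distinct xs ≤ distinct ys
  distinct-⊆ xs sub = distinct-≤ xs (∈-deduplicate⁺ _≟_ ∘ sub)

  Unique-≤-distinct : ∀ {xs ys} → Unique xs → xs ⊆ ys → length xs ≤ distinct ys
  Unique-≤-distinct u sub = Unique-⊆⇒length≤ u (∈-deduplicate⁺ _≟_ ∘ sub)

  -- A head recurring in the tail would be filtered out of the deduplicated tail, leaving too few
  -- elements. This later turns an exact number of cycles into distinctness of their
  -- representatives.
  length≤distinct⇒Unique : ∀ xs → length xs ≤ distinct xs → Unique xs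
  length≤distinct⇒Unique []       le = []
  length≤distinct⇒Unique (x ∷ xs) (s≤s le) =
    All.¬Any⇒All¬ xs x∉xs ∷
    length≤distinct⇒Unique xs (ℕ.≤-trans le (List.length-filter _ (deduplicate _≟_ xs)))
    where
    x∉xs : x ∉ xs
    x∉xs x∈xs = ℕ.<-irrefl refl (begin-strict
      length xs                               ≤⟨ le ⟩
      length (filter _ (deduplicate _≟_ xs))  <⟨ List.filter-notAll _ _ x-dropped ⟩
      length (deduplicate _≟_ xs)             ≤⟨ List.length-deduplicate _≟_ xs ⟩
      length xs                               ∎)
      where
      open ℕ.≤-Reasoning
      x-dropped = Any.map (λ eq ¬eq → ¬eq eq) (∈-deduplicate⁺ _≟_ x∈xs)

  module _ {p : ℕ} (pp : Prime p) (g : A → A) (per : ∀ x → iterate g x p ≡ x) where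

    open DecMembership _≟_ using (_∈?_)

    private instance
      p≢0 : NonZero p
      p≢0 = prime⇒nonZero pp

    -- Without fixed points every orbit of g has exactly p elements, so orbits can be
    -- removed one at a time.
    p∣length : ∀ {xs} → Acc _<_ (length xs) → Unique xs → (∀ {x} → x ∈ xs → g x ∈ xs) →
               (∀ {x} → x ∈ xs → g x ≢ x) → p ∣ length xs
    p∣length {[]}     _         u closed free = p ∣0
    p∣length {y ∷ ys} (acc rec) u closed free = subst (p ∣_) (sym len) (∣m∣n⇒∣m+n
      (∣-reflexive (sym lenO))
      (p∣length (rec shrink) (Unique.filter⁺ out? u) closed′ (free ∘ proj₁ ∘ ∈-filter⁻ out?)))
      where
      xs = y ∷ ys
      orbit = applyUpTo (iterate g y) p
      in? = _∈? orbit
      out? = ¬? ∘ in?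
      ∈orbit : ∀ m → iterate g y m ∈ orbit
      ∈orbit m = subst (_∈ orbit) (iterate-% g (per y) m) (∈-applyUpTo⁺ (iterate g y) (m%n<n m p))
      orbit-closed : ∀ {x} n → x ∈ orbit → iterate g x n ∈ orbit
      orbit-closed n x∈ with m , _ , refl ← ∈-applyUpTo⁻ (iterate g y) x∈ =
        subst (_∈ orbit) (iterate-+ g y m n) (∈orbit (m + n))
      xs-closed : ∀ {x} n → x ∈ xs → iterate g x n ∈ xs
      xs-closed zero    x∈ = x∈
      xs-closed (suc n) x∈ = xs-closed n (closed x∈)
      len : length xs ≡ length (filter in? xs) + length (filter out? xs)
      len = length-filter-¬? in? xs
      lenO : length (filter in? xs) ≡ p
      lenO = trans (Unique-⊆-antisym
        (Unique.filter⁺ in? u)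
        (Unique.applyUpTo⁺₁ _ p (iterate-prime-distinct pp (per y) (free (here refl))))
        (proj₂ ∘ ∈-filter⁻ in? {xs = xs})
        (λ x∈ → let m , _ , eq = ∈-applyUpTo⁻ (iterate g y) x∈ in
                ∈-filter⁺ in? (subst (_∈ xs) (sym eq) (xs-closed m (here refl))) x∈))
        (List.length-applyUpTo (iterate g y) p)
      shrink : length (filter out? xs) < length xs
      shrink = List.filter-notAll out? xs (here (λ y∉ → y∉ (∈orbit 0)))
      closed′ : ∀ {x} → x ∈ filter out? xs → g x ∈ filter out? xs
      closed′ {x} x∈ with x∈xs , x∉ ← ∈-filter⁻ out? {xs = xs} x∈ =
        -- From `g x`, a further p - 1 steps lead back to x, so an orbit containing `g x` contains
        -- x.
        ∈-filter⁺ out? (closed x∈xs) λ gx∈ →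
          x∉ (subst (_∈ orbit) (trans (cong (iterate g x) (ℕ.suc-pred p)) (per x))
                (orbit-closed (pred p) gx∈))

    private
      fixed? : Decidable (λ x → g x ≡ x)
      fixed? x = g x ≟ x

      moved? : Decidable (λ x → g x ≢ x)
      moved? = ¬? ∘ fixed?

    -- The (p - 1)-st iterate of `g` undoes `g`, so it cancels one `g` from g (g x) ≡ g x.
    moved-closed : ∀ {xs} → (∀ {x} → x ∈ xs → g x ∈ xs) →
                   ∀ {x} → x ∈ filter moved? xs → g x ∈ filter moved? xs
    moved-closed {xs} closed {x} x∈ with x∈xs , gx≢x ← ∈-filter⁻ moved? {xs = xs} x∈ =
      ∈-filter⁺ moved? (closed x∈xs) λ ggx≡gx → gx≢x (begin
        g x                          ≡⟨ cong g return ⟨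
        g (iterate g (g x) (pred p)) ≡⟨ iterate-shift g (g x) (pred p) ⟨
        iterate g (g (g x)) (pred p) ≡⟨ cong (λ z → iterate g z (pred p)) ggx≡gx ⟩
        iterate g (g x) (pred p)     ≡⟨ return ⟩
        x                            ∎)
      where
      open ≡-Reasoning
      return : iterate g (g x) (pred p) ≡ x
      return = trans (cong (iterate g x) (ℕ.suc-pred p)) (per x)

    -- The moved elements form a closed list without fixed points, so `p∣length` applies to them.
    fixedPoints : ∀ {xs} → Unique xs → (∀ {x} → x ∈ xs → g x ∈ xs) →
                  ∃[ t ] length xs ≡ length (filter (λ x → g x ≟ x) xs) + t * p
    fixedPoints {xs} u closed
      with divides t eq ← p∣length (<-wellFounded _) (Unique.filter⁺ moved? u)
        (moved-closed closed) (λ {x} → proj₂ ∘ ∈-filter⁻ moved? {v = x} {xs = xs})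
      = t , trans (length-filter-¬? fixed? xs) (cong (λ k → length (filter fixed? xs) + k) eq)

private module ∈-Fin {n} = DecMembership (Fin._≟_ {n})
open ∈-Fin using (_∈?_)

toList≡tabulate : ∀ {A : Set} {n} (xs : Vec A n) → Vec.toList xs ≡ List.tabulate (lookup xs)
toList≡tabulate []       = refl
toList≡tabulate (x ∷ xs) = cong (x ∷_) (toList≡tabulate xs)

_≟ᵛ_ : ∀ {n m} → DecidableEquality (Vec (Fin n) m)
_≟ᵛ_ = Vec.≡-dec Fin._≟_

_≟ˢ_ : ∀ {n} → DecidableEquality (Subset n)
_≟ˢ_ = Vec.≡-dec Bool._≟_

lookup-extensional : ∀ {A : Set} {n} {xs ys : Vec A n} → lookup xs ≗ lookup ys → xs ≡ ys
lookup-extensional {xs = xs} {ys} eq =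
  trans (sym (Vec.tabulate∘lookup xs)) (trans (Vec.tabulate-cong eq) (Vec.tabulate∘lookup ys))

-- Cycles of permutations

module _ {n : ℕ} where

  infix 8 _∙_
  _∙_ : Vec (Fin n) n → Fin n → Fin n
  σ ∙ i = lookup σ i

  Permutation : Vec (Fin n) n → Set
  Permutation σ = Injective _≡_ _≡_ (lookup σ)

  orbit : Vec (Fin n) n → Fin n → List (Fin n)
  orbit σ i = List.iterate (lookup σ) i n

  lookup-cycleOf : ∀ σ i j → lookup (cycleOf σ i) j ≡ does (j ∈? orbit σ i)
  lookup-cycleOf σ i = Vec.lookup∘tabulate (λ j → does (j ∈? orbit σ i))

  -- Unfolds to `distinct _≟ˢ_ (map (cycleOf σ) (allFin n))`, so the bounds on `distinct` apply
  -- directly.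
  #cycles : Vec (Fin n) n → ℕ
  #cycles σ = length (cycles σ)

  ∈-orbit⁻ : ∀ σ {i j} → j ∈ orbit σ i → ∃[ m ] j ≡ iterate (lookup σ) i m
  ∈-orbit⁻ σ {i} j∈ rewrite iterate≡applyUpTo (lookup σ) i n
    with m , _ , eq ← ∈-applyUpTo⁻ _ j∈ = m , eq

  ∈-cycleOf⁻ : ∀ σ {i j} → j ∈ˢ cycleOf σ i → ∃[ m ] j ≡ iterate (lookup σ) i m
  ∈-cycleOf⁻ σ {i} {j} j∈
    with j ∈? orbit σ i | trans (sym (lookup-cycleOf σ i j)) (Vec.[]=⇒lookup j∈)
  ... | yes j∈o | _ = ∈-orbit⁻ σ j∈o

  module _ (σ : Vec (Fin n) n) (perm : Permutation σ) where

    private s = lookup σ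

    -- Two of the first n + 1 iterates coincide, and injectivity cancels the initial steps they
    -- share. The bound r < n is what makes the orbit list, cut off after n entries, contain every
    -- iterate.
    period : ∀ i → ∃[ r ] r < n × iterate s i (suc r) ≡ i
    period i with a , b , a<b , eq ← Fin.pigeonhole (ℕ.n<1+n n) (λ a → iterate s i (toℕ a))
             with r , a+r≡b ← ℕ.m≤n⇒∃[o]m+o≡n a<b
      = r , ℕ.≤-trans (ℕ.≤-trans (s≤s (ℕ.m≤n+m r (toℕ a))) (ℕ.≤-reflexive a+r≡b))
                      (Fin.toℕ≤pred[n] b)
          , iterate-injective s perm (toℕ a) (begin
              iterate s (iterate s i (suc r)) (toℕ a)  ≡⟨ iterate-+ s i (suc r) (toℕ a) ⟨
              iterate s i (suc r + toℕ a)              ≡⟨ cong (iterate s (s i)) (ℕ.+-comm r _) ⟩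
              iterate s i (suc (toℕ a) + r)            ≡⟨ cong (iterate s i) a+r≡b ⟩
              iterate s i (toℕ b)                      ≡⟨ eq ⟨
              iterate s i (toℕ a)                      ∎)
      where open ≡-Reasoning

    ∈-orbit⁺ : ∀ i m → iterate s i m ∈ orbit σ i
    ∈-orbit⁺ i m with r , r<n , per ← period i
      rewrite iterate≡applyUpTo s i n | sym (iterate-% s per m)
      = ∈-applyUpTo⁺ (iterate s i) (ℕ.<-≤-trans (m%n<n m (suc r)) r<n)

    ∈-cycleOf⁺ : ∀ i m → iterate s i m ∈ˢ cycleOf σ i
    ∈-cycleOf⁺ i m = Vec.lookup⇒[]= _ _ (trans (lookup-cycleOf σ i (iterate s i m))
      (dec-true (iterate s i m ∈? orbit σ i) (∈-orbit⁺ i m)))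

    cycleOf-step : ∀ i → cycleOf σ (σ ∙ i) ≡ cycleOf σ i
    cycleOf-step i = Subset.⊆-antisym
      (λ j∈ → case ∈-cycleOf⁻ σ j∈ of λ { (m , refl) → ∈-cycleOf⁺ i (suc m) })
      (λ j∈ → case ∈-cycleOf⁻ σ j∈ of λ { (m , refl) → back m })
      where
      back : ∀ m → iterate s i m ∈ˢ cycleOf σ (σ ∙ i)
      back m with r , _ , per ← period i =
        -- Starting at `σ ∙ i`, r steps return to i and m more follow. The form `r + 0 + m` is what
        -- `1 * suc r + m` computes to after its first step.
        subst (_∈ˢ cycleOf σ (σ ∙ i)) (iterate-*-+ s {r = suc r} per 1 m)
          (∈-cycleOf⁺ (σ ∙ i) (r + 0 + m))

    cycleOf-iterate : ∀ i m → cycleOf σ (iterate s i m) ≡ cycleOf σ i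
    cycleOf-iterate i zero    = refl
    cycleOf-iterate i (suc m) = trans (cycleOf-iterate (s i) m) (cycleOf-step i)

    cycleOf-≡ : ∀ {i j} → cycleOf σ i ≡ cycleOf σ j → ∃[ m ] i ≡ iterate s j m
    cycleOf-≡ {i} eq = ∈-cycleOf⁻ σ (subst (i ∈ˢ_) eq (∈-cycleOf⁺ i 0))

  Permutation⇒Unique : ∀ {σ} → Permutation σ → Unique (Vec.toList σ)
  Permutation⇒Unique {σ} perm = subst Unique (sym (toList≡tabulate σ)) (Unique.tabulate⁺ perm)

  Unique⇒Permutation : ∀ {σ} → Unique (Vec.toList σ) → Permutation σ
  Unique⇒Permutation {σ} u = Unique-tabulate⁻ (subst Unique (toList≡tabulate σ) u)

-- The list of permutations with k cycles

∈-words : ∀ {n m} (w : Vec (Fin n) m) → w ∈ words n m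
∈-words []      = here refl
∈-words (x ∷ w) = ∈-cartesianProductWith⁺ _∷_ (∈-allFin x) (∈-words w)

words-unique : ∀ n m → Unique (words n m)
words-unique n zero    = [] ∷ []
words-unique n (suc m) =
  Unique.cartesianProductWith⁺ _∷_ Vec.∷-injective (Unique.allFin⁺ n) (words-unique n m)

-- stirling₁ n k is by definition the length of this list.
permutationsWith : ∀ n k → List (Vec (Fin n) n)
permutationsWith n k = filter (λ σ → #cycles σ ℕ.≟ k) (permutations n)

module _ {n k : ℕ} where

  private
    perm? = λ (σ : Vec (Fin n) n) → unique? Fin._≟_ (Vec.toList σ)
    k-cycles? = λ (σ : Vec (Fin n) n) → #cycles σ ℕ.≟ k

  permutationsWith-unique : Unique (permutationsWith n k)
  permutationsWith-unique = Unique.filter⁺ k-cycles? (Unique.filter⁺ perm? (words-unique n n))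

  ∈-permutationsWith⁺ : ∀ {σ} → Permutation σ → #cycles σ ≡ k → σ ∈ permutationsWith n k
  ∈-permutationsWith⁺ {σ} perm eq =
    ∈-filter⁺ k-cycles? (∈-filter⁺ perm? (∈-words σ) (Permutation⇒Unique perm)) eq

  ∈-permutationsWith⁻ : ∀ {σ} → σ ∈ permutationsWith n k → Permutation σ × #cycles σ ≡ k
  ∈-permutationsWith⁻ σ∈ with σ∈p , eq ← ∈-filter⁻ k-cycles? {xs = permutations n} σ∈ =
    Unique⇒Permutation (proj₂ (∈-filter⁻ perm? {xs = words n n} σ∈p)) , eq

-- Conjugation

module _ {n : ℕ} (c c⁻¹ : Fin n → Fin n) where

  conj : Vec (Fin n) n → Vec (Fin n) n
  conj σ = tabulate (λ i → c (σ ∙ c⁻¹ i))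

  lookup-conj : ∀ σ i → conj σ ∙ i ≡ c (σ ∙ c⁻¹ i)
  lookup-conj σ = Vec.lookup∘tabulate _

  iterate-conj : ∀ σ m → iterate conj σ m ≡ tabulate (λ i → iterate c (σ ∙ iterate c⁻¹ i m) m)
  iterate-conj σ zero    = sym (Vec.tabulate∘lookup σ)
  iterate-conj σ (suc m) = trans (iterate-conj (conj σ) m) (Vec.tabulate-cong λ i →
    cong (λ j → iterate c j m) (trans (lookup-conj σ _)
      (cong (λ j → c (σ ∙ j)) (sym (iterate-shift c⁻¹ i m)))))

  module _ (c∘c⁻¹ : ∀ i → c (c⁻¹ i) ≡ i) (c⁻¹∘c : ∀ i → c⁻¹ (c i) ≡ i) where

    conj-permutation : ∀ {σ} → Permutation σ → Permutation (conj σ)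
    conj-permutation {σ} perm {i} {j} eq = inj {g = c} c∘c⁻¹ (perm (inj {f = c} {g = c⁻¹} c⁻¹∘c
        (trans (sym (lookup-conj σ i)) (trans eq (lookup-conj σ j)))))
      where
      inj : ∀ {f g : Fin n → Fin n} → (∀ i → g (f i) ≡ i) → ∀ {i j} → f i ≡ f j → i ≡ j
      inj {g = g} gf eq = trans (sym (gf _)) (trans (cong g eq) (gf _))

    iterate-lookup-conj : ∀ σ i m →
                          iterate (lookup (conj σ)) (c i) m ≡ c (iterate (lookup σ) i m)
    iterate-lookup-conj σ = iterate-semiconj (lookup (conj σ)) (lookup σ) c
      (λ i → trans (lookup-conj σ (c i)) (cong (λ j → c (σ ∙ j)) (c⁻¹∘c i)))

    -- `c` carries the m-th iterate of i under σ to the m-th iterate of c i under the conjugate, so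
    -- the two lists of n iterates correspond entry by entry. The image under `c` of a
    -- characteristic vector is read off through `c⁻¹`.
    cycleOf-conj : ∀ σ i → cycleOf (conj σ) (c i) ≡ tabulate (λ j → lookup (cycleOf σ i) (c⁻¹ j))
    cycleOf-conj σ i = Vec.tabulate-cong λ j →
      trans (does-⇔ (mk⇔ (to j) (from j)) (j ∈? orbit (conj σ) (c i)) (c⁻¹ j ∈? orbit σ i))
            (sym (lookup-cycleOf σ i (c⁻¹ j)))
      where
      to : ∀ j → j ∈ orbit (conj σ) (c i) → c⁻¹ j ∈ orbit σ i
      to j j∈
        rewrite iterate≡applyUpTo (lookup (conj σ)) (c i) n | iterate≡applyUpTo (lookup σ) i n
        with m , m<n , refl ← ∈-applyUpTo⁻ _ j∈ =
        subst (_∈ applyUpTo (iterate (lookup σ) i) n)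
          (trans (sym (c⁻¹∘c _)) (cong c⁻¹ (sym (iterate-lookup-conj σ i m))))
          (∈-applyUpTo⁺ (iterate (lookup σ) i) m<n)
      from : ∀ j → c⁻¹ j ∈ orbit σ i → j ∈ orbit (conj σ) (c i)
      from j j∈
        rewrite iterate≡applyUpTo (lookup (conj σ)) (c i) n | iterate≡applyUpTo (lookup σ) i n
        with m , m<n , eq ← ∈-applyUpTo⁻ _ j∈ =
        subst (_∈ applyUpTo (iterate (lookup (conj σ)) (c i)) n)
          (trans (iterate-lookup-conj σ i m) (trans (cong c (sym eq)) (c∘c⁻¹ j)))
          (∈-applyUpTo⁺ (iterate (lookup (conj σ)) (c i)) m<n)

    -- Each cycle of the conjugate is a relabelled cycle of σ, and relabelling a list keeps its
    -- length.
    #cycles-conj-≤ : ∀ σ → #cycles (conj σ) ≤ #cycles σ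
    #cycles-conj-≤ σ = subst (#cycles (conj σ) ≤_) (List.length-map relabel (cycles σ))
      (distinct-≤ _≟ˢ_ (map (cycleOf (conj σ)) (allFin n)) sub)
      where
      relabel : Subset n → Subset n
      relabel v = tabulate (λ j → lookup v (c⁻¹ j))
      sub : map (cycleOf (conj σ)) (allFin n) ⊆ map relabel (cycles σ)
      sub v∈ with i , _ , refl ← ∈-map⁻ (cycleOf (conj σ)) v∈ =
        subst (_∈ map relabel (cycles σ))
          (trans (sym (cycleOf-conj σ (c⁻¹ i))) (cong (cycleOf (conj σ)) (c∘c⁻¹ i)))
          (∈-map⁺ relabel (∈-deduplicate⁺ _≟ˢ_ (∈-map⁺ (cycleOf σ) (∈-allFin (c⁻¹ i)))))

-- Conjugating back with `c` and `c⁻¹` exchanged restores σ and gives the reverse inequality.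
#cycles-conj : ∀ {n} (c c⁻¹ : Fin n → Fin n) → (∀ i → c (c⁻¹ i) ≡ i) → (∀ i → c⁻¹ (c i) ≡ i) →
               ∀ σ → #cycles (conj c c⁻¹ σ) ≡ #cycles σ
#cycles-conj c c⁻¹ cc⁻¹ c⁻¹c σ = ℕ.≤-antisym (#cycles-conj-≤ c c⁻¹ cc⁻¹ c⁻¹c σ)
  (subst (λ τ → #cycles τ ≤ #cycles (conj c c⁻¹ σ)) undo
    (#cycles-conj-≤ c⁻¹ c c⁻¹c cc⁻¹ (conj c c⁻¹ σ)))
  where
  undo : conj c⁻¹ c (conj c c⁻¹ σ) ≡ σ
  undo = lookup-extensional λ i → begin
    conj c⁻¹ c (conj c c⁻¹ σ) ∙ i     ≡⟨ lookup-conj c⁻¹ c (conj c c⁻¹ σ) i ⟩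
    c⁻¹ (conj c c⁻¹ σ ∙ c i)          ≡⟨ cong c⁻¹ (lookup-conj c c⁻¹ σ (c i)) ⟩
    c⁻¹ (c (σ ∙ c⁻¹ (c i)))           ≡⟨ c⁻¹c _ ⟩
    σ ∙ c⁻¹ (c i)                     ≡⟨ cong (σ ∙_) (c⁻¹c i) ⟩
    σ ∙ i                             ∎
    where open ≡-Reasoning

-- Permutations commuting with a p-cycle

-- c rotates the c-orbit of o, which has p elements, and fixes the d remaining points D e.
module Rotation {n p d : ℕ} (pp : Prime p) (d<p : suc d < p) (o : Fin n) (c : Fin n → Fin n)
                (D : Fin d → Fin n) (D-injective : Injective _≡_ _≡_ D)
                (period-c : ∀ x → iterate c x p ≡ x) (co≢o : c o ≢ o)
                (cD : ∀ e → c (D e) ≡ D e)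
                (cover : ∀ x → (∃[ b ] x ≡ iterate c o b) ⊎ (∃[ e ] x ≡ D e)) where

  private instance
    p≢0 : NonZero p
    p≢0 = prime⇒nonZero pp

  c⁻¹ : Fin n → Fin n
  c⁻¹ x = iterate c x (pred p)

  c⁻¹∘c : ∀ x → c⁻¹ (c x) ≡ x
  c⁻¹∘c x = trans (cong (iterate c x) (ℕ.suc-pred p)) (period-c x)

  c∘c⁻¹ : ∀ x → c (c⁻¹ x) ≡ x
  c∘c⁻¹ x = trans (sym (iterate-shift c x (pred p))) (c⁻¹∘c x)

  c-injective : Injective _≡_ _≡_ c
  c-injective {x} {y} eq = trans (sym (c⁻¹∘c x)) (trans (cong c⁻¹ eq) (c⁻¹∘c y))

  iterate-c-comm : ∀ x a b → iterate c (iterate c x a) b ≡ iterate c (iterate c x b) a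
  iterate-c-comm x a b = trans (sym (iterate-+ c x a b))
    (trans (cong (iterate c x) (ℕ.+-comm a b)) (iterate-+ c x b a))

  iterate-cD : ∀ e a → iterate c (D e) a ≡ D e
  iterate-cD e zero    = refl
  iterate-cD e (suc a) = trans (cong (λ x → iterate c x a) (cD e)) (iterate-cD e a)

  c-moves-orbit : ∀ b → c (iterate c o b) ≢ iterate c o b
  c-moves-orbit b eq = co≢o (iterate-injective c c-injective b
    (trans (iterate-shift c o b) eq))

  g : Vec (Fin n) n → Vec (Fin n) n
  g = conj c c⁻¹

  -- The p-th iterate of conjugation by `c` is conjugation by the p-th power of `c`, which is the
  -- identity.
  period-g : ∀ σ → iterate g σ p ≡ σ
  period-g σ = trans (iterate-conj c c⁻¹ σ p) (lookup-extensional λ i →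
    trans (Vec.lookup∘tabulate _ i) (trans (period-c _) (cong (σ ∙_) (period-c⁻¹ i))))
    where
    cancel : ∀ m x → iterate c⁻¹ (iterate c x m) m ≡ x
    cancel zero    x = refl
    cancel (suc m) x = trans
      (cong (λ y → iterate c⁻¹ (c⁻¹ y) m) (iterate-shift c x m))
      (trans (cong (λ y → iterate c⁻¹ y m) (c⁻¹∘c _)) (cancel m x))
    period-c⁻¹ : ∀ x → iterate c⁻¹ x p ≡ x
    period-c⁻¹ x = trans (cong (λ y → iterate c⁻¹ y p) (sym (period-c x))) (cancel p x)

  g-fixed⇒commutes : ∀ {σ} → g σ ≡ σ → ∀ x → σ ∙ c x ≡ c (σ ∙ x)
  g-fixed⇒commutes {σ} fix x = begin
    σ ∙ c x             ≡⟨ cong (_∙ c x) fix ⟨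
    g σ ∙ c x           ≡⟨ lookup-conj c c⁻¹ σ (c x) ⟩
    c (σ ∙ c⁻¹ (c x))   ≡⟨ cong (λ y → c (σ ∙ y)) (c⁻¹∘c x) ⟩
    c (σ ∙ x)           ∎
    where open ≡-Reasoning

  commutes⇒g-fixed : ∀ {σ} → (∀ x → σ ∙ c x ≡ c (σ ∙ x)) → g σ ≡ σ
  commutes⇒g-fixed {σ} comm = lookup-extensional λ x →
    trans (lookup-conj c c⁻¹ σ x) (trans (sym (comm (c⁻¹ x))) (cong (σ ∙_) (c∘c⁻¹ x)))

  -- Candidates for a full list of cycles: one for the whole p-orbit and one for each remaining
  -- point.
  representatives : Vec (Fin n) n → List (Subset n)
  representatives σ = cycleOf σ o ∷ List.tabulate (cycleOf σ ∘ D)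

  length-representatives : ∀ σ → length (representatives σ) ≡ suc d
  length-representatives σ = cong suc (List.length-tabulate (cycleOf σ ∘ D))

  module Commuting {σ : Vec (Fin n) n} (perm : Permutation σ)
                   (comm : ∀ x → σ ∙ c x ≡ c (σ ∙ x)) where

    s = lookup σ

    -- Commuting with `c` spreads the action at `o` along its orbit: there `s` is the a-th power of
    -- `c`.
    s-on-orbit : ∀ a → s o ≡ iterate c o a → ∀ b → s (iterate c o b) ≡ iterate c (iterate c o b) a
    s-on-orbit a so b = begin
      s (iterate c o b)              ≡⟨ iterate-semiconj c c s (sym ∘ comm) o b ⟨
      iterate c (s o) b              ≡⟨ cong (λ x → iterate c x b) so ⟩
      iterate c (iterate c o a) b    ≡⟨ iterate-c-comm o a b ⟩
      iterate c (iterate c o b) a    ∎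
      where open ≡-Reasoning

    iterate-s : ∀ {a} → s o ≡ iterate c o a → ∀ m → iterate s o m ≡ iterate c o (m * a)
    iterate-s {a} so zero    = refl
    iterate-s {a} so (suc m) = begin
      iterate s (s o) m              ≡⟨ iterate-shift s o m ⟩
      s (iterate s o m)              ≡⟨ cong s (iterate-s so m) ⟩
      s (iterate c o (m * a))        ≡⟨ s-on-orbit a so (m * a) ⟩
      iterate c (iterate c o (m * a)) a  ≡⟨ iterate-c-comm o (m * a) a ⟩
      iterate c (iterate c o a) (m * a)  ≡⟨ iterate-+ c o a (m * a) ⟨
      iterate c o (a + m * a)        ∎
      where open ≡-Reasoning

    module _ {a : ℕ} (0<a : 0 < a) (a<p : a < p) (so : s o ≡ iterate c o a) where

      -- Since a is invertible modulo p, some iterate of `s` takes `o` to `c o`. It commutes with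
      -- `c`, so it advances every point of the orbit by one, and the whole orbit is one cycle of σ.
      cycleOf-orbit : ∀ b → cycleOf σ (iterate c o b) ≡ cycleOf σ o
      cycleOf-orbit zero    = refl
      cycleOf-orbit (suc b) with m , gen ← generator pp 0<a a<p = begin
        cycleOf σ (iterate c (c o) b)             ≡⟨ cong (λ x → cycleOf σ (iterate c x b)) s^m ⟨
        cycleOf σ (iterate c (iterate s o m) b)   ≡⟨ cong (cycleOf σ) s^m-comm ⟩
        cycleOf σ (iterate s (iterate c o b) m)   ≡⟨ cycleOf-iterate σ perm (iterate c o b) m ⟩
        cycleOf σ (iterate c o b)                 ≡⟨ cycleOf-orbit b ⟩
        cycleOf σ o                               ∎
        where
        open ≡-Reasoning
        s^m-comm : iterate c (iterate s o m) b ≡ iterate s (iterate c o b) m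
        s^m-comm = iterate-semiconj c c (λ x → iterate s x m)
          (λ x → sym (iterate-semiconj s s c comm x m)) o b
        s^m : iterate s o m ≡ c o
        s^m = trans (iterate-s so m) (gen c (period-c o))

      cycles-⊆ : map (cycleOf σ) (allFin n) ⊆ representatives σ
      cycles-⊆ v∈ with ∈-map⁻ (cycleOf σ) v∈
      ... | x , _ , refl with cover x
      ...   | inj₁ (b , refl) = here (cycleOf-orbit b)
      ...   | inj₂ (e , refl) = there (∈-tabulate⁺ {f = cycleOf σ ∘ D} e)

      -- All cycles occur among the d + 1 representatives, so having d + 1 cycles makes these
      -- distinct. The image of `D e` is fixed by `c`, hence is off the p-orbit and is some `D e′`;
      -- it shares the cycle of `D e`, so e′ = e.
      fixes-D : #cycles σ ≡ suc d → ∀ e → s (D e) ≡ D e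
      fixes-D count e with cover (s (D e))
      ... | inj₁ (b , eq) = contradiction
              (trans (cong c (sym eq)) (trans (sym (comm (D e))) (trans (cong s (cD e)) eq)))
              (c-moves-orbit b)
      ... | inj₂ (e′ , eq) = trans eq (cong D (Unique-tabulate⁻ unique-D
              (trans (cong (cycleOf σ) (sym eq)) (cycleOf-step σ perm (D e)))))
        where
        unique : Unique (representatives σ)
        unique = length≤distinct⇒Unique _≟ˢ_ _ (ℕ.≤-trans
          (ℕ.≤-reflexive (trans (length-representatives σ) (sym count)))
          (distinct-⊆ _≟ˢ_ (map (cycleOf σ) (allFin n)) cycles-⊆))
        unique-D : Unique (List.tabulate (cycleOf σ ∘ D))
        unique-D with _ ∷ u ← unique = u

    -- If `s` fixed `o`, it would fix all p points of the orbit, giving at least p > d + 1 cycles.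
    so≢o : #cycles σ ≡ suc d → s o ≢ o
    so≢o count so = ℕ.<⇒≱ d<p (ℕ.≤-trans
      (ℕ.≤-reflexive (sym (List.length-applyUpTo f p)))
      (ℕ.≤-trans (Unique-≤-distinct _≟ˢ_ (Unique.applyUpTo⁺₁ f p f-distinct) sub)
                 (ℕ.≤-reflexive count)))
      where
      f = λ b → cycleOf σ (iterate c o b)
      fixed : ∀ b m → iterate s (iterate c o b) m ≡ iterate c o b
      fixed b zero    = refl
      fixed b (suc m) = trans (cong (λ x → iterate s x m) (s-on-orbit 0 so b)) (fixed b m)
      f-distinct : ∀ {i j} → i < j → j < p → f i ≢ f j
      f-distinct {i} {j} i<j j<p eq with m , reach ← cycleOf-≡ σ perm eq =
        iterate-prime-distinct pp (period-c o) co≢o i<j j<p (trans reach (fixed j m))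
      sub : applyUpTo f p ⊆ map (cycleOf σ) (allFin n)
      sub v∈ with b , _ , refl ← ∈-applyUpTo⁻ f v∈ = ∈-map⁺ (cycleOf σ) (∈-allFin (iterate c o b))

    s-on-o : #cycles σ ≡ suc d → ∃[ a ] 0 < a × a < p × s o ≡ iterate c o a
    s-on-o count with cover (s o)
    ... | inj₁ (a , eq) = a % p , ℕ.n≢0⇒n>0 a%p≢0 , m%n<n a p , eq′
      where
      eq′ : s o ≡ iterate c o (a % p)
      eq′ = trans eq (sym (iterate-% c (period-c o) a))
      a%p≢0 : a % p ≢ 0
      a%p≢0 z = so≢o count (trans eq′ (cong (iterate c o) z))
    -- If `s o` were some `D e`, it would be fixed by `c`, so `s (c o)` = `s o` and `c o` = `o` by
    -- injectivity.
    ... | inj₂ (e , eq) = contradiction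
            (perm (trans (comm o) (trans (cong c eq) (trans (cD e) (sym eq))))) co≢o

  power : ℕ → Vec (Fin n) n
  power a = tabulate (λ x → iterate c x a)

  lookup-power : ∀ a x → power a ∙ x ≡ iterate c x a
  lookup-power a = Vec.lookup∘tabulate _

  power-permutation : ∀ a → Permutation (power a)
  power-permutation a eq = iterate-injective c c-injective a
    (trans (sym (lookup-power a _)) (trans eq (lookup-power a _)))

  power-commutes : ∀ a x → power a ∙ c x ≡ c (power a ∙ x)
  power-commutes a x = trans (lookup-power a (c x))
    (trans (iterate-shift c x a) (cong c (sym (lookup-power a x))))

  -- `cycles-⊆` gives the upper bound. For the lower one, `power a` fixes each `D e`, so the cycles
  -- of these points differ from each other and from that of `o`.
  #cycles-power : ∀ {a} → 0 < a → a < p → #cycles (power a) ≡ suc d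
  #cycles-power {a} 0<a a<p = ℕ.≤-antisym
    (ℕ.≤-trans (distinct-≤ _≟ˢ_ (map (cycleOf σ) (allFin n)) (cycles-⊆ 0<a a<p so))
               (ℕ.≤-reflexive (length-representatives σ)))
    (ℕ.≤-trans (ℕ.≤-reflexive (sym (length-representatives σ)))
               (Unique-≤-distinct _≟ˢ_ unique sub))
    where
    σ = power a
    perm : Permutation σ
    perm = power-permutation a
    so = lookup-power a o
    open Commuting {σ} perm (power-commutes a)
    fixed : ∀ e m → iterate s (D e) m ≡ D e
    fixed e zero    = refl
    fixed e (suc m) = trans
      (cong (λ x → iterate s x m) (trans (lookup-power a (D e)) (iterate-cD e a))) (fixed e m)
    o≢D : ∀ e → cycleOf σ o ≢ cycleOf σ (D e)
    o≢D e eq with m , reach ← cycleOf-≡ σ perm eq =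
      co≢o (trans (cong c o≡) (trans (cD e) (sym o≡)))
      where
      o≡ : o ≡ D e
      o≡ = trans reach (fixed e m)
    unique : Unique (representatives σ)
    unique = All.tabulate⁺ o≢D ∷ Unique.tabulate⁺ λ {e} {e′} eq →
      case cycleOf-≡ σ perm eq of λ { (m , reach) → D-injective (trans reach (fixed e′ m)) }
    sub : representatives σ ⊆ map (cycleOf σ) (allFin n)
    sub (here refl) = ∈-map⁺ (cycleOf σ) (∈-allFin o)
    sub (there v∈) with e , refl ← ∈-tabulate⁻ v∈ = ∈-map⁺ (cycleOf σ) (∈-allFin (D e))

  #fixed : length (filter (λ σ → g σ ≟ᵛ σ) (permutationsWith n (suc d))) ≡ pred p
  #fixed = trans (Unique-⊆-antisym
      (Unique.filter⁺ fixed? (permutationsWith-unique {n} {suc d}))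
      (Unique.applyUpTo⁺₁ f (pred p) f-distinct) to from)
    (List.length-applyUpTo f (pred p))
    where
    fixed? = λ σ → g σ ≟ᵛ σ
    T = permutationsWith n (suc d)
    -- Index i stands for exponent i + 1, so the exponents run from 1 to p - 1 and the identity is
    -- left out.
    f = power ∘ suc
    suc<p : ∀ {i} → i < pred p → suc i < p
    suc<p i< = ℕ.<-≤-trans (s<s i<) (ℕ.≤-reflexive (ℕ.suc-pred p))
    f-distinct : ∀ {i j} → i < j → j < pred p → f i ≢ f j
    f-distinct {i} {j} i<j j< eq =
      iterate-prime-distinct pp (period-c o) co≢o (s<s i<j) (suc<p j<)
        (trans (sym (lookup-power (suc i) o)) (trans (cong (_∙ o) eq) (lookup-power (suc j) o)))
    to : filter fixed? T ⊆ applyUpTo f (pred p)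
    to {σ} σ∈ with σ∈T , fix ← ∈-filter⁻ fixed? {xs = T} σ∈
      with perm , count ← ∈-permutationsWith⁻ {n} {suc d} σ∈T
      with suc a , 0<a , a<p , so ← Commuting.s-on-o {σ} perm (g-fixed⇒commutes fix) count =
      subst (_∈ applyUpTo f (pred p)) (lookup-extensional agree)
        (∈-applyUpTo⁺ f (ℕ.<⇒≤pred a<p))
      where
      open Commuting {σ} perm (g-fixed⇒commutes fix)
      agree : ∀ x → power (suc a) ∙ x ≡ σ ∙ x
      agree x = trans (lookup-power (suc a) x) (case cover x of λ where
        (inj₁ (b , refl)) → sym (s-on-orbit (suc a) so b)
        (inj₂ (e , refl)) → trans (iterate-cD e (suc a)) (sym (fixes-D 0<a a<p so count e)))
    from : applyUpTo f (pred p) ⊆ filter fixed? T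
    from σ∈ with a , a< , refl ← ∈-applyUpTo⁻ f σ∈ = ∈-filter⁺ fixed?
      (∈-permutationsWith⁺ {σ = power (suc a)} (power-permutation (suc a))
        (#cycles-power z<s (suc<p a<)))
      (commutes⇒g-fixed {power (suc a)} (power-commutes (suc a)))

  p∣1+stirling₁ : p ∣ suc (stirling₁ n (suc d))
  p∣1+stirling₁ with t , eq ← fixedPoints _≟ᵛ_ pp g period-g (permutationsWith-unique {n} {suc d})
      (λ {σ} σ∈ → let perm , count = ∈-permutationsWith⁻ {n} {suc d} σ∈ in
        ∈-permutationsWith⁺ {σ = g σ} (conj-permutation c c⁻¹ c∘c⁻¹ c⁻¹∘c {σ} perm)
          (trans (#cycles-conj c c⁻¹ c∘c⁻¹ c⁻¹∘c σ) count))
    -- The count is (p - 1) + t * p, so its successor is (t + 1) * p.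
    = divides (suc t) (trans (cong suc (trans eq (cong (_+ t * p) #fixed)))
                             (cong (_+ t * p) (ℕ.suc-pred p)))

-- The rotation of the first p points of Fin (p + d)

module _ {q d : ℕ} (pp : Prime (suc q)) where

  private p = suc q

  next : Fin p → Fin p
  next i = suc (toℕ i) mod p

  rotate : Fin (p + d) → Fin (p + d)
  rotate x = [ (λ i → next i ↑ˡ d) , p ↑ʳ_ ]′ (splitAt p x)

  rotate-↑ˡ : ∀ i → rotate (i ↑ˡ d) ≡ next i ↑ˡ d
  rotate-↑ˡ i rewrite Fin.splitAt-↑ˡ p i d = refl

  rotate-↑ʳ : ∀ e → rotate (p ↑ʳ e) ≡ p ↑ʳ e
  rotate-↑ʳ e rewrite Fin.splitAt-↑ʳ p d e = refl

  iterate-rotate : ∀ i m → iterate rotate (i ↑ˡ d) m ≡ iterate next i m ↑ˡ d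
  iterate-rotate = iterate-semiconj rotate next (_↑ˡ d) rotate-↑ˡ

  toℕ-next : ∀ i → toℕ (next i) ≡ suc (toℕ i) % p
  toℕ-next i = Fin.toℕ-fromℕ< _

  1<p : 1 < p
  1<p = nonTrivial⇒n>1 p {{prime⇒nonTrivial pp}}

  toℕ-iterate-next : ∀ m → toℕ (iterate next Fin.zero m) ≡ m % p
  toℕ-iterate-next zero    = refl
  toℕ-iterate-next (suc m) = begin
    toℕ (iterate next (next Fin.zero) m)   ≡⟨ cong toℕ (iterate-shift next Fin.zero m) ⟩
    toℕ (next (iterate next Fin.zero m))   ≡⟨ toℕ-next (iterate next Fin.zero m) ⟩
    suc (toℕ (iterate next Fin.zero m)) % p ≡⟨ cong (λ k → suc k % p) (toℕ-iterate-next m) ⟩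
    (1 + m % p) % p                        ≡⟨ cong (λ k → (k + m % p) % p) (m<n⇒m%n≡m 1<p) ⟨
    (1 % p + m % p) % p                    ≡⟨ %-distribˡ-+ 1 m p ⟨
    suc m % p                              ∎
    where open ≡-Reasoning

  iterate-next-toℕ : ∀ i → iterate next Fin.zero (toℕ i) ≡ i
  iterate-next-toℕ i = Fin.toℕ-injective
    (trans (toℕ-iterate-next (toℕ i)) (m<n⇒m%n≡m (Fin.toℕ<n i)))

  -- Each i is itself an iterate of zero, and iterates commute, so the period at zero suffices.
  period-next : ∀ i → iterate next i p ≡ i
  period-next i = begin
    iterate next i p
      ≡⟨ cong (λ j → iterate next j p) (iterate-next-toℕ i) ⟨
    iterate next (iterate next Fin.zero (toℕ i)) p
      ≡⟨ iterate-+ next Fin.zero (toℕ i) p ⟨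
    iterate next Fin.zero (toℕ i + p)
      ≡⟨ cong (iterate next Fin.zero) (ℕ.+-comm (toℕ i) p) ⟩
    iterate next Fin.zero (p + toℕ i)
      ≡⟨ iterate-+ next Fin.zero p (toℕ i) ⟩
    iterate next (iterate next Fin.zero p) (toℕ i)
      ≡⟨ cong (λ j → iterate next j (toℕ i)) period₀ ⟩
    iterate next Fin.zero (toℕ i)
      ≡⟨ iterate-next-toℕ i ⟩
    i ∎
    where
    open ≡-Reasoning
    period₀ : iterate next Fin.zero p ≡ Fin.zero
    period₀ = Fin.toℕ-injective (trans (toℕ-iterate-next p) (n%n≡0 p))

  splitAt-cases : ∀ {P : Fin (p + d) → Set} → (∀ i → P (i ↑ˡ d)) → (∀ e → P (p ↑ʳ e)) → ∀ x → P x
  splitAt-cases {P} left right x = subst P (Fin.join-splitAt p d x) (go (splitAt p x))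
    where
    go : ∀ y → P (join p d y)
    go (inj₁ i) = left i
    go (inj₂ e) = right e

  stirling₁-mod : suc d < p → p ∣ suc (stirling₁ (p + d) (suc d))
  stirling₁-mod d<p = Rotation.p∣1+stirling₁ pp d<p Fin.zero rotate (p ↑ʳ_)
    (Fin.↑ʳ-injective p _ _)
    (splitAt-cases (λ i → trans (iterate-rotate i p) (cong (_↑ˡ d) (period-next i)))
                   (λ e → fixed e p))
    -- `rotate` moves zero because its image has value 1 % p = 1.
    (λ eq → ℕ.1+n≢0 (trans (sym (m<n⇒m%n≡m 1<p)) (trans (sym (toℕ-next Fin.zero))
      (cong toℕ (Fin.↑ˡ-injective d _ _ (trans (sym (rotate-↑ˡ Fin.zero)) eq))))))
    rotate-↑ʳ
    (splitAt-cases (λ i → inj₁ (toℕ i , sym (trans (iterate-rotate Fin.zero (toℕ i))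
                                                    (cong (_↑ˡ d) (iterate-next-toℕ i)))))
                   (λ e → inj₂ (e , refl)))
    where
    fixed : ∀ e m → iterate rotate (p ↑ʳ e) m ≡ p ↑ʳ e
    fixed e zero    = refl
    fixed e (suc m) = trans (cong (λ x → iterate rotate x m) (rotate-↑ʳ e)) (fixed e m)

-- Möbius sums at primes and denominators

if-yes : ∀ {P A : Set} (P? : Dec P) {x y : A} → P → (if does P? then x else y) ≡ x
if-yes (yes _) _ = refl
if-yes (no ¬p) p = contradiction p ¬p

if-no : ∀ {P A : Set} (P? : Dec P) {x y : A} → ¬ P → (if does P? then x else y) ≡ y
if-no (yes p) ¬p = contradiction p ¬p
if-no (no _)  _  = refl

μ-prime : ∀ {p} → Prime p → μ p ≡ -1ℤ
μ-prime {suc q} pp =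
  cong (λ ps → if does (unique? ℕ._≟_ ps) then -1ℤ ℤ.^ length ps else 0ℤ)
    -- Factorisations are unique up to permutation, and a permutation of a singleton is that
    -- singleton.
    (↭-singleton-inv (factorisationUnique (factorise (suc q)) (primeFactorisation[p] pp)))

-- Stated for an arbitrary index function `f`, since the tail of `applyUpTo f` is indexed by
-- `f ∘ suc`.
sum-last : ∀ (t : ℕ → ℤ) (f : ℕ → ℕ) r → (∀ i → i < r → t (f i) ≡ 0ℤ) →
           foldr ℤ._+_ 0ℤ (map t (applyUpTo f (suc r))) ≡ t (f r)
sum-last t f zero    z = ℤ.+-identityʳ (t (f 0))
sum-last t f (suc r) z = trans
  (cong₂ ℤ._+_ (z 0 z<s) (sum-last t (f ∘ suc) r (λ i i<r → z (suc i) (s<s i<r))))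
  (ℤ.+-identityˡ (t (f (suc r))))

μ⋆-prime : ∀ A {p} → Prime p → μ⋆ A p ≡ + A p ℤ.- + A 1
μ⋆-prime A {suc zero}      pp = contradiction pp ¬prime[1]
μ⋆-prime A {p@(suc (suc r))} pp = trans
  -- Index i stands for the divisor i + 1, and p = r + 2: index 0 contributes μ(p) A(1) = -A(1),
  -- index r + 1 contributes μ(1) A(p) = A(p), and the indices between give non-divisors of p.
  (cong₂ ℤ._+_ first (trans (sum-last term suc r middle) last))
  (ℤ.+-comm (ℤ.- (+ A 1)) (+ A p))
  where
  term : ℕ → ℤ
  term i = if does (suc i ∣? p) then μ (p / suc i) ℤ.* + A (suc i) else 0ℤ
  first : term 0 ≡ ℤ.- (+ A 1)
  first = trans (if-yes (1 ∣? p) (1∣ p)) (trans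
    (cong (ℤ._* + A 1) (trans (cong μ (n/1≡n p)) (μ-prime pp))) (ℤ.-1*i≡-i (+ A 1)))
  middle : ∀ i → i < r → term (suc i) ≡ 0ℤ
  middle i i<r = if-no (2+ i ∣? p) λ div → case prime⇒irreducible pp div of λ where
    (inj₂ eq) → ℕ.<⇒≢ (s<s (s<s i<r)) eq
  last : term (suc r) ≡ + A p
  last = trans (if-yes (p ∣? p) ∣-refl) (trans
    (cong (ℤ._* + A p) (cong μ (n/n≡1 p))) (ℤ.*-identityˡ (+ A p)))

-- The reduced denominator times gcd(z, p) is p, so p divides one factor; dividing the gcd would
-- make it divide z.
prime∣denom : ∀ {z p} → Prime p → .{{_ : NonZero p}} → ¬ (+ p ℤ.∣ z) → p ∣ ℚ.↧ₙ (z ℚ./ p)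
prime∣denom {z} {p} pp p∤z
  with euclidsLemma (ℚ.↧ₙ (z ℚ./ p)) _ pp (∣-reflexive (sym (trans
         (sym (ℤ.abs-* (ℚ.↧ (z ℚ./ p)) (ℤ.gcd z (+ p)))) (cong ℤ.∣_∣ (ℚ.↧-/ z p)))))
... | inj₁ p∣denom = p∣denom
... | inj₂ p∣gcd   = contradiction (ℤ.∣ᵤ⇒∣ (∣-trans p∣gcd (ℤ.gcd[i,j]∣i z (+ p)))) p∤z

-- Large primes and the contradiction

larger-prime : ∀ n → ∃[ p ] Prime p × n < p
-- Euclid's argument: a prime factor of n! + 1 that is at most n would divide n! and hence 1.
larger-prime n with factorise (suc (n !))
... | record { factors = []     ; isFactorisation = eq } =
  contradiction (ℕ.suc-injective eq) (ℕ.>⇒≢ (ℕ.1≤n! n))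
... | record { factors = p ∷ ps ; isFactorisation = eq ; factorsPrime = pp ∷ _ } =
  p , pp , ℕ.≰⇒> λ p≤n → contradiction
    (subst Prime (∣1⇒≡1 (∣m+n∣m⇒∣n {p} {n !} {1}
      (subst (p ∣_) (trans (sym eq) (ℕ.+-comm 1 (n !))) (m∣m*n (product ps)))
      (∣-trans (n∣n! {{prime⇒nonZero pp}}) (m≤n⇒m!∣n! p≤n)))) pp)
    ¬prime[1]
  where
  n∣n! : ∀ {n} .{{_ : NonZero n}} → n ∣ n !
  n∣n! {suc n} = m∣m*n (n !)

prime∣Fail : ∀ {A m p} → IsFail A m → Prime p → p ∣ suc (A p) → suc (A 1) < p → p ∣ m
prime∣Fail {A} {m} {p} fail pp p∣ A1<p = ∣-trans (prime∣denom pp p∤) (IsFail.multiple fail p)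
  where
  instance
    p≢0 : NonZero p
    p≢0 = prime⇒nonZero pp
  p∤ : ¬ (+ p ℤ.∣ μ⋆ A p)
  -- If p divided A(p) - A(1), then, dividing A(p) + 1 as well, it would divide the difference A(1)
  -- + 1, which is positive and smaller than p.
  p∤ div = ℕ.<⇒≱ A1<p (∣⇒≤ (ℤ.∣⇒∣ᵤ (subst (+ p ℤ.∣_) difference
      (ℤ.∣m∣n⇒∣m-n (ℤ.∣ᵤ⇒∣ {+ p} {+ suc (A p)} p∣) div))))
    where
    difference : + suc (A p) ℤ.- μ⋆ A p ≡ + suc (A 1)
    difference = begin
      + suc (A p) ℤ.- μ⋆ A p                    ≡⟨ cong (λ z → + suc (A p) ℤ.- z) (μ⋆-prime A pp) ⟩
      (1ℤ ℤ.+ + A p) ℤ.- (+ A p ℤ.- + A 1)      ≡⟨ solve 2 (λ a b → (con 1ℤ :+ a) :- (a :- b)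
                                                     := con 1ℤ :+ b) refl (+ A p) (+ A 1) ⟩
      + suc (A 1)                               ∎
      where open ≡-Reasoning
            open ℤ-Solver

S⁽¹⁾-mod-prime : ∀ {k p} → Prime p → 1 ≤ k → k < p → p ∣ suc (S⁽¹⁾ k p)
S⁽¹⁾-mod-prime {suc d} {suc q} pp _ k<p =
  -- The index p + k - 1 with p = q + 1 and k = d + 1 computes to `q + suc d`, which must be
  -- rewritten to `suc q + d`.
  subst (λ n → suc q ∣ suc (stirling₁ n (suc d))) (sym (ℕ.+-suc q d)) (stirling₁-mod pp k<p)

theorem6 : (k : ℕ) → k ≥ 1 → ¬ AlmostRealizable (S⁽¹⁾ k)
theorem6 k k≥1 ((m , fail) , _)
  -- The sum bounds three quantities at once: p > k and p > A(1) + 1 yield p ∣ m, while p > m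
  -- contradicts this as m is positive.
  with p , pp , big<p ← larger-prime (m + suc (S⁽¹⁾ k 1) + k) =
  ℕ.<⇒≱ (ℕ.≤-<-trans (ℕ.≤-trans (ℕ.m≤m+n m _) (ℕ.m≤m+n _ k)) big<p)
    (∣⇒≤ {{IsFail.positive fail}} (prime∣Fail fail pp
      (S⁽¹⁾-mod-prime pp k≥1 (ℕ.≤-<-trans (ℕ.m≤n+m k _) big<p))
      (ℕ.≤-<-trans (ℕ.≤-trans (ℕ.m≤n+m _ m) (ℕ.m≤m+n _ k)) big<p)))
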